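{- Let $n\ge1$ and let $H=(h_1>h_2>\cdots>h_p=1)$ be a decreasing gap sequence. Then $$W_n(H)\ \ge\ \max\left\{D_1(n),\ \max_{2\le j\le p}\left\lceil\frac{D_j(n)}{h_{j-1}}\right\rceil\right\},$$ and for every $1\le s<p$, $$W_n(H)\ \ge\ \frac{U_s(n)}{h_s(2h_{s+1}-1)}.$$ Both bounds also hold with $C_n(H)$ in place of $W_n(H)$.
   Context: Shellsort: a gap sequence is a decreasing sequence of positive integers $H=(h_1>h_2>\cdots>h_p=1)$. On an array of $n$ distinct keys (a permutation), pass $j$ runs ordinary insertion sort separately on each $h_j$-chain, i.e. on each set of positions with the same remainder modulo $h_j$: the key is repeatedly compared with the key $h_j$ positions before it, exchanging the two if they are out of order, until no exchange is needed or the start of the chain is reached. Passes are run for $j=1,2,\dots,p$. $W_n(H)$ and $C_n(H)$ are the worst-case (over all inputs of $n$ keys) total numbers of exchanges and of comparisons. For $0\le s\le p$, $S_s=\{\sum_{i=1}^s x_ih_i: x_i\in\mathbb N_0\}$ (so $S_0=\{0\}$). For $1\le j\le p$: $M_j=\lfloor (n-1)/h_j\rfloor$, $G_j(n)=\{1\le m\le M_j: mh_j\notin S_{j-1}\}$, $D_j(n)=\sum_{m\in G_j(n)}(n-mh_j)$. For $0\le s\le p$: $U_s(n)=\sum_{1\le d<n,\ d\notin S_s}(n-d)$. -}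

module Defs where

open import Data.Fin as Fin using (Fin; zero; suc; fromℕ; fromℕ<; inject₁; inject!)
open import Data.Fin.Properties as Finₚ using (any?)
open import Data.List as List using (List; []; _∷_; map; filter; upTo; applyUpTo; allFin; cartesianProductWith)
open import Data.List.Extrema.Nat using (max)
open import Data.List.Membership.Propositional using (_∈_)
open import Data.List.Membership.Propositional.Properties using (∈-cartesianProductWith⁺; ∈-allFin; ∈-filter⁺)
open import Data.List.Relation.Unary.Any using (here)
open import Data.Nat
open import Data.Nat.DivMod using (_/_)
import Data.Nat.ListAction as ListAction
open import Data.Nat.Properties
open import Algebra.Properties.CommutativeMonoid.Sum +-0-commutativeMonoid using (sum)
open import Data.Product using (Σ; ∃; _,_; proj₁; proj₂)
open import Data.Sum using (inj₁; inj₂)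
open import Data.Vec as Vec using (Vec; []; _∷_; lookup; _[_]≔_)
open import Data.Vec.Functional as Vector using (Vector)
open import Data.Vec.Relation.Unary.AllPairs using (allPairs?)
open import Data.Vec.Relation.Unary.Unique.Propositional using (Unique)
open import Function using (_∘_)
open import Relation.Nullary using (yes; no; ¬?)
open import Relation.Nullary.Decidable using (map′)
open import Relation.Binary.PropositionalEquality
open import Relation.Unary using (Decidable)

-- Indices are 0-based: a sequence with p = suc q gaps has  h i = h_{i+1}
-- for i = 0, …, q.
record GapSequence (q : ℕ) : Set where
  field
    h          : Vector ℕ (suc q)
    decreasing : ∀ {i j} → i Fin.< j → h i > h j
    last≡1     : h (fromℕ q) ≡ 1

  h≥1 : ∀ i → h i ≥ 1
  h≥1 i with m≤n⇒m<n∨m≡n (Finₚ.≤fromℕ i)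
  ... | inj₁ i<q = <⇒≤ (≤-<-trans (≤-reflexive (sym last≡1)) (decreasing i<q))
  ... | inj₂ i≡q = ≤-reflexive (sym (trans (cong h (Finₚ.toℕ-injective i≡q)) last≡1))

  instance
    h-nonZero : ∀ {i} → NonZero (h i)
    h-nonZero {i} = >-nonZero (h≥1 i)

    h[2h∸1]-nonZero : ∀ {i j} → NonZero (h i * (2 * h j ∸ 1))
    h[2h∸1]-nonZero {i} {j} = >-nonZero (*-mono-≤ (h≥1 i) (∸-monoˡ-≤ 1 (*-monoʳ-≤ 2 (h≥1 j))))

record State (n : ℕ) : Set where
  constructor state
  field
    keys        : Vec (Fin n) n
    exchanges   : ℕ
    comparisons : ℕ

open State public

exchange : ∀ {A : Set} {n} → Fin n → Fin n → Vec A n → Vec A n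
exchange i j xs = (xs [ i ]≔ lookup xs j) [ j ]≔ lookup xs i

predecessor< : ∀ h r k {n} → r + suc k * h < n → r + k * h < n
predecessor< h r k = ≤-<-trans (+-monoʳ-≤ r (m≤n+m (k * h) h))

-- Position r + k * h is the k-th position of the h-chain of remainder r.
-- `sift` moves the key found there towards the start of the chain.
sift : ∀ {n} (h r k : ℕ) → .(r + k * h < n) → State n → State n
sift h r zero    _ s = s
sift h r (suc k) b (state xs e c)
  with lookup xs (fromℕ< b) Finₚ.<? lookup xs (fromℕ< (predecessor< h r k b))
... | yes _ = sift h r k (predecessor< h r k b)
                (state (exchange (fromℕ< (predecessor< h r k b)) (fromℕ< b) xs) (suc e) (suc c))
... | no  _ = state xs e (suc c)

sortChainUpTo : ∀ {n} (h r k : ℕ) → State n → State n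
sortChainUpTo         h r zero    s = s
sortChainUpTo {n = n} h r (suc k) s with r + k * h <? n
... | yes b = sift h r k b (sortChainUpTo h r k s)
... | no  _ = sortChainUpTo h r k s

-- For h ≥ 1, every position r + k * h < n of the chain has k < n.
sortChain : ∀ {n} (h r : ℕ) → State n → State n
sortChain {n} h r = sortChainUpTo h r n

pass : ∀ {n} → State n → ℕ → State n
pass s h = List.foldl (λ s r → sortChain h r s) s (upTo h)

shellsort : ∀ {q n} → GapSequence q → Vec (Fin n) n → State n
shellsort H xs = Vector.foldl pass (state xs 0 0) (GapSequence.h H)

vectors : ∀ n k → List (Vec (Fin n) k)
vectors n zero    = [] ∷ []
vectors n (suc k) = cartesianProductWith _∷_ (allFin n) (vectors n k)

distinct? : ∀ {n k} → Decidable (Unique {A = Fin n} {k})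
distinct? = allPairs? (λ x y → ¬? (x Finₚ.≟ y))

inputs : ∀ n → List (Vec (Fin n) n)
inputs n = filter distinct? (vectors n n)

∈-vectors : ∀ {n k} (xs : Vec (Fin n) k) → xs ∈ vectors n k
∈-vectors []       = here refl
∈-vectors (x ∷ xs) = ∈-cartesianProductWith⁺ _∷_ (∈-allFin x) (∈-vectors xs)

∈-inputs : ∀ {n} {xs : Vec (Fin n) n} → Unique xs → xs ∈ inputs n
∈-inputs {xs = xs} = ∈-filter⁺ distinct? (∈-vectors xs)

W : ∀ {q} → ℕ → GapSequence q → ℕ
W n H = max 0 (map (exchanges ∘ shellsort H) (inputs n))

C : ∀ {q} → ℕ → GapSequence q → ℕ
C n H = max 0 (map (comparisons ∘ shellsort H) (inputs n))

Combination : ∀ {k} → Vector ℕ k → ℕ → Set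
Combination {k} g d = ∃ λ (x : Vector ℕ k) → d ≡ sum (λ i → x i * g i)

-- Only coefficients x₀ ≤ d need to be searched: if g₀ = 0 then x₀ may be
-- taken to be 0, and otherwise x₀ ≤ x₀ * g₀ ≤ d.
combination? : ∀ {k} (g : Vector ℕ k) → Decidable (Combination g)
combination? {zero}  g d = map′ (λ d≡0 → (λ ()) , d≡0) proj₂ (d ≟ 0)
combination? {suc k} g d = map′ to from (any? split?)
  where
  g₀ = g zero
  g′ = Vector.tail g

  Split : Fin (suc d) → Set
  Split x = Σ (Fin.toℕ x * g₀ ≤ d) λ _ → Combination g′ (d ∸ Fin.toℕ x * g₀)

  split? : Decidable Split
  split? x with Fin.toℕ x * g₀ ≤? d | combination? g′ (d ∸ Fin.toℕ x * g₀)
  ... | yes p | yes q = yes (p , q)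
  ... | no ¬p | _     = no (¬p ∘ proj₁)
  ... | _     | no ¬q = no (¬q ∘ proj₂)

  to : ∃ Split → Combination g d
  to (x , x*g₀≤d , y , eq) =
    (Fin.toℕ x Vector.∷ y) , trans (sym (m+[n∸m]≡n x*g₀≤d)) (cong (Fin.toℕ x * g₀ +_) eq)

  split : ∀ c (y : Vector ℕ k) → c ≤ d → d ≡ c * g₀ + sum (λ i → y i * g′ i) → ∃ Split
  split c y c≤d d≡ = fromℕ< (s≤s c≤d) ,
    subst (λ c → Σ (c * g₀ ≤ d) λ _ → Combination g′ (d ∸ c * g₀)) (sym (Finₚ.toℕ-fromℕ< (s≤s c≤d)))
      ( m+n≤o⇒m≤o (c * g₀) (≤-reflexive (sym d≡))
      , y , trans (cong (_∸ c * g₀) d≡) (m+n∸m≡n (c * g₀) _))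

  from : Combination g d → ∃ Split
  from (x , d≡) with g₀ ≟ 0
  ... | yes g₀≡0 = split 0 (Vector.tail x) z≤n
                     (trans d≡ (cong (_+ sum (λ i → x (suc i) * g′ i)) (trans (cong (x zero *_) g₀≡0) (*-zeroʳ (x zero)))))
  ... | no  g₀≢0 = split (x zero) (Vector.tail x)
                     (≤-trans (m≤m*n (x zero) g₀ {{≢-nonZero g₀≢0}})
                              (m+n≤o⇒m≤o (x zero * g₀) (≤-reflexive (sym d≡))))
                     d≡

-- The index s ranges over 0, …, p, with p = suc q.
S : ∀ {q} → GapSequence q → Fin (suc (suc q)) → ℕ → Set
S H s = Combination {Fin.toℕ s} (λ i → h (inject! i))
  where open GapSequence H

S? : ∀ {q} (H : GapSequence q) s → Decidable (S H s)
S? H s = combination? (λ i → h (inject! i))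
  where open GapSequence H

-- By the 0-based indexing of gaps, M H j n, G H j n and D H j n are
-- M_{j+1}, G_{j+1}(n) and D_{j+1}(n), so G H j n refers to S_j.

M : ∀ {q} → GapSequence q → Fin (suc q) → ℕ → ℕ
M H j n = (n ∸ 1) / h j
  where open GapSequence H

[1…_] : ℕ → List ℕ
[1… m ] = applyUpTo suc m

G : ∀ {q} → GapSequence q → Fin (suc q) → ℕ → List ℕ
G H j n = filter (λ m → ¬? (S? H (inject₁ j) (m * h j))) [1… M H j n ]
  where open GapSequence H

D : ∀ {q} → GapSequence q → Fin (suc q) → ℕ → ℕ
D H j n = ListAction.sum (map (λ m → n ∸ m * h j) (G H j n))
  where open GapSequence H

U : ∀ {q} → GapSequence q → Fin (suc (suc q)) → ℕ → ℕ
U H s n = ListAction.sum (map (n ∸_) (filter (λ d → ¬? (S? H s d)) [1… n ∸ 1 ]))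

⌈_/_⌉ : (a b : ℕ) .{{_ : NonZero b}} → ℕ
⌈ a / b ⌉ = (a + (b ∸ 1)) / b

-- Two facts about insertion sort bound the number of exchanges from below.  A
-- pass on keys that are already sorted along its chains exchanges nothing, and
-- an exchange of keys p e positions apart removes at most 2 p ∸ 1 of the
-- inversions between positions congruent modulo e.  After the pass of gap e
-- none of these are left, so an input that is idle for the first s gaps costs
-- at least (its inversions along e-chains) / (2 p ∸ 1) exchanges.
--
-- Such inputs are the linear extensions of the order "y ∸ x lies in the
-- semigroup S_s".  That order is covered by the h_s chains of residues modulo
-- h_s, and a linear extension can delay a given chain so that every incomparable
-- pair x < y with x on the chain is inverted.  Hence the h_s extensions together
-- invert every pair with y ∸ x ∉ S_s, and their inversions add up to at least
-- D_{s+1}(n), or U_s(n) for e = 1.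
module Submission where

open import Defs
open import Data.Fin as Fin using (Fin; zero; suc; inject₁; inject!; fromℕ; fromℕ<; toℕ)
open import Data.Fin.Permutation as Permutation using (_⟨$⟩ʳ_)
import Data.Fin.Permutation.Components as Components
import Data.Fin.Properties as Finₚ
open import Data.Integer as ℤ using (+_)
import Data.Integer.Properties as ℤₚ
open import Data.List as List using (List; []; _∷_; tabulate; filter; applyUpTo)
open import Data.List.Extrema.Nat using (max; v≤max⁺; max≤v⁺)
open import Data.List.Membership.Propositional using (_∈_)
import Data.List.Membership.Propositional.Properties as ∈ₚ
open import Data.List.Relation.Unary.All using (All; []; _∷_)
import Data.List.Relation.Unary.All.Properties as Allₚ
open import Data.List.Relation.Unary.Any as Any using (here; there)
import Data.List.Relation.Unary.Any.Properties as Anyₚ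
open import Data.Nat
  using (ℕ; zero; suc; _+_; _*_; _∸_; _⊔_; _≤_; _<_; _≥_; z≤n; s≤s; s≤s⁻¹; s<s⁻¹; NonZero; >-nonZero; >-nonZero⁻¹;
         _<?_; _≤?_; _≟_)
open import Data.Nat.DivMod using (_%_; m≡m%n+[m/n]*n; [m+kn]%n≡m%n; m<n⇒m%n≡m; m%n<n; m/n≤m; m<n*o⇒m/o<n)
import Data.Nat.DivMod as ℕ
import Data.Nat.ListAction as ListAction
open import Data.Nat.Properties
open import Data.Product using (∃; _×_; _,_; proj₁; proj₂)
open import Data.Rational as ℚ using (_/_)
import Data.Rational.Properties as ℚₚ
import Data.Rational.Unnormalised as ℚᵘ
import Data.Rational.Unnormalised.Properties as ℚᵘₚ
open import Data.Sum using (_⊎_; inj₁; inj₂)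
open import Data.Unit using (tt)
open import Data.Vec as Vec using (Vec; lookup)
import Data.Vec.Properties as Vecₚ
open import Data.Vec.Functional as Vector using (Vector)
open import Data.Vec.Relation.Unary.Unique.Propositional using (Unique)
import Data.Vec.Relation.Unary.Unique.Propositional.Properties as Uniqueₚ
open import Function using (_∘_; id)
open import Relation.Binary.Definitions using (tri<; tri≈; tri>)
open import Relation.Binary.PropositionalEquality
open import Relation.Nullary using (Dec; yes; no; ¬_; ¬?; contradiction)
open import Relation.Nullary.Decidable using (_×-dec_; _⊎-dec_)
open import Relation.Unary using (Decidable)

open import Algebra.Properties.CommutativeMonoid.Sum +-0-commutativeMonoid
  using (sum; ∑-distrib-+; ∑-comm; sum-permute; sum-cong-≗)

-- Counting

𝟙 : ∀ {P : Set} → Dec P → ℕ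
𝟙 (yes _) = 1
𝟙 (no  _) = 0

𝟙-mono : ∀ {P Q : Set} (P? : Dec P) (Q? : Dec Q) → (P → Q) → 𝟙 P? ≤ 𝟙 Q?
𝟙-mono (no _)  _        _ = z≤n
𝟙-mono (yes p) (yes _)  _ = ≤-refl
𝟙-mono (yes p) (no ¬q)  f = contradiction (f p) ¬q

𝟙-⊎ : ∀ {P Q R : Set} (P? : Dec P) (Q? : Dec Q) (R? : Dec R) → (P → Q ⊎ R) → 𝟙 P? ≤ 𝟙 Q? + 𝟙 R?
𝟙-⊎ (no _)  _  _  _ = z≤n
𝟙-⊎ (yes p) Q? R? f with f p
... | inj₁ q = ≤-trans (𝟙-mono (yes p) Q? (λ _ → q)) (m≤m+n _ _)
... | inj₂ r with R?
...   | yes _ = m≤n+m 1 (𝟙 Q?)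
...   | no ¬r = contradiction r ¬r

𝟙-disjoint : ∀ {P Q R : Set} (P? : Dec P) (Q? : Dec Q) (R? : Dec R) →
             (P → R) → (Q → R) → (P → ¬ Q) → 𝟙 P? + 𝟙 Q? ≤ 𝟙 R?
𝟙-disjoint (no _)  Q?      R? _ g _ = 𝟙-mono Q? R? g
𝟙-disjoint (yes p) (yes q) R? _ _ d = contradiction q (d p)
𝟙-disjoint (yes p) (no _)  R? f _ _ = 𝟙-mono (yes p) R? f

sum-mono : ∀ {n} {f g : Vector ℕ n} → (∀ i → f i ≤ g i) → sum f ≤ sum g
sum-mono {zero}  f≤g = z≤n
sum-mono {suc n} f≤g = +-mono-≤ (f≤g zero) (sum-mono (f≤g ∘ suc))

sum-const : ∀ n c → sum {n} (λ _ → c) ≡ n * c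
sum-const zero    c = refl
sum-const (suc n) c = cong (λ m → c + m) (sum-const n c)

term≤sum : ∀ {n} (f : Vector ℕ n) i → f i ≤ sum f
term≤sum f zero    = m≤m+n _ _
term≤sum f (suc i) = ≤-trans (term≤sum (f ∘ suc) i) (m≤n+m _ _)

𝟙≤count : ∀ {n} {P : Fin n → Set} (P? : Decidable P) {Q : Set} (Q? : Dec Q) →
          (Q → ∃ P) → 𝟙 Q? ≤ sum (λ i → 𝟙 (P? i))
𝟙≤count P? (no _)  _ = z≤n
𝟙≤count P? (yes q) f = ≤-trans (𝟙-mono (yes q) (P? (proj₁ (f q))) (λ _ → proj₂ (f q)))
                               (term≤sum (λ i → 𝟙 (P? i)) _)

count≤𝟙 : ∀ {n} {P : Fin n → Set} (P? : Decidable P) {Q : Set} (Q? : Dec Q) →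
          (∀ {i} → P i → Q) → (∀ {i j} → P i → P j → i ≡ j) →
          sum (λ i → 𝟙 (P? i)) ≤ 𝟙 Q?
count≤𝟙 {zero}  P? Q? f uniq = z≤n
count≤𝟙 {suc n} P? Q? f uniq with P? zero
... | no _  = count≤𝟙 (P? ∘ suc) Q? f (λ p p′ → Finₚ.suc-injective (uniq p p′))
... | yes p = ≤-trans
  -- By uniqueness a hit at `zero` excludes any later one, so the tail is counted against the false
  -- proposition decided by `no id`.
  (s≤s (count≤𝟙 (P? ∘ suc) (no id) (λ p′ → contradiction (uniq p p′) λ ())
                                   (λ p′ p″ → Finₚ.suc-injective (uniq p′ p″))))
  (𝟙-mono (yes p) Q? f)

k≤count-< : ∀ {k n} → k ≤ n → k ≤ sum {n} (λ i → 𝟙 (toℕ i <? k))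
k≤count-< z≤n       = z≤n
k≤count-< (s≤s {k} {n} k≤n) = s≤s (≤-trans (k≤count-< k≤n)
  (sum-mono {n} λ i → 𝟙-mono (toℕ i <? k) (suc (toℕ i) <? suc k) s≤s))

sum₂ : ∀ {m n} → (Fin m → Fin n → ℕ) → ℕ
sum₂ f = sum (λ x → sum (f x))

sum₂-mono : ∀ {m n} {f g : Fin m → Fin n → ℕ} → (∀ x y → f x y ≤ g x y) → sum₂ f ≤ sum₂ g
sum₂-mono f≤g = sum-mono (λ x → sum-mono (f≤g x))

sum₂-distrib-+ : ∀ {m n} (f g : Fin m → Fin n → ℕ) → sum₂ (λ x y → f x y + g x y) ≡ sum₂ f + sum₂ g
sum₂-distrib-+ f g = trans (sum-cong-≗ λ x → ∑-distrib-+ (f x) (g x)) (∑-distrib-+ (λ x → sum (f x)) (λ x → sum (g x)))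

sum₂-permute : ∀ {n} (f : Fin n → Fin n → ℕ) (π : Permutation.Permutation′ n) →
               sum₂ f ≡ sum₂ (λ x y → f (π ⟨$⟩ʳ x) (π ⟨$⟩ʳ y))
sum₂-permute f π = trans (sum-permute (λ x → sum (f x)) π)
                         (sum-cong-≗ λ x → sum-permute (f (π ⟨$⟩ʳ x)) π)

sum-sum₂-comm : ∀ {k m n} (f : Fin k → Fin m → Fin n → ℕ) →
                sum (λ i → sum₂ (f i)) ≡ sum₂ (λ x y → sum (λ i → f i x y))
sum-sum₂-comm f = trans (∑-comm (λ i x → sum (f i x))) (sum-cong-≗ λ x → ∑-comm (λ i y → f i x y))

-- Exchanges

-- The graph of the transposition as an indexed family: matching on it settles the case and the
-- image of `x` at once.
data Transposed {n} (a b x : Fin n) : Fin n → Set where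
  first  : x ≡ a → Transposed a b x b
  second : x ≡ b → Transposed a b x a
  fixed  : x ≢ a → x ≢ b → Transposed a b x x

transposed : ∀ {n} (a b x : Fin n) → Transposed a b x (Components.transpose a b x)
transposed a b x with x Finₚ.≟ a
... | yes x≡a = first x≡a
... | no  x≢a with x Finₚ.≟ b
...   | yes x≡b = second x≡b
...   | no  x≢b = fixed x≢a x≢b

module _ {A : Set} {n : ℕ} {a b : Fin n} (a≢b : a ≢ b) (xs : Vec A n) where

  lookup-exchangeˡ : lookup (exchange a b xs) a ≡ lookup xs b
  lookup-exchangeˡ = trans (Vecₚ.lookup∘update′ a≢b (xs Vec.[ a ]≔ lookup xs b) _) (Vecₚ.lookup∘update a xs _)

  lookup-exchangeʳ : lookup (exchange a b xs) b ≡ lookup xs a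
  lookup-exchangeʳ = Vecₚ.lookup∘update b (xs Vec.[ a ]≔ lookup xs b) _

  lookup-exchange-other : ∀ {x} → x ≢ a → x ≢ b → lookup (exchange a b xs) x ≡ lookup xs x
  lookup-exchange-other x≢a x≢b =
    trans (Vecₚ.lookup∘update′ x≢b (xs Vec.[ a ]≔ lookup xs b) _) (Vecₚ.lookup∘update′ x≢a xs _)

  lookup-exchange-transposed : ∀ {x x′} → Transposed a b x x′ → lookup (exchange a b xs) x′ ≡ lookup xs x
  lookup-exchange-transposed (first refl)      = lookup-exchangeʳ
  lookup-exchange-transposed (second refl)     = lookup-exchangeˡ
  lookup-exchange-transposed (fixed x≢a x≢b) = lookup-exchange-other x≢a x≢b

-- Inversions along chains

Chain : ∀ e .{{_ : NonZero e}} → ℕ → ℕ → Set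
Chain e x y = x < y × x % e ≡ y % e

chain? : ∀ e .{{_ : NonZero e}} x y → Dec (Chain e x y)
chain? e x y = x <? y ×-dec x % e ≟ y % e

module _ {e : ℕ} .{{_ : NonZero e}} where

  Chain⇒< : ∀ {x y} → Chain e x y → x ℕ./ e < y ℕ./ e
  Chain⇒< {x} {y} (x<y , x≡y) = *-cancelʳ-< e _ _ (+-cancelˡ-< (x % e) _ _ (begin-strict
    x % e + (x ℕ./ e) * e  ≡⟨ m≡m%n+[m/n]*n x e ⟨
    x                      <⟨ x<y ⟩
    y                      ≡⟨ m≡m%n+[m/n]*n y e ⟩
    y % e + (y ℕ./ e) * e  ≡⟨ cong (_+ (y ℕ./ e) * e) (sym x≡y) ⟩
    x % e + (y ℕ./ e) * e  ∎))
    where open ≤-Reasoning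

  Chain⇒≡ : ∀ {x y} → Chain e x y → ∃ λ m → y ≡ x + suc m * e
  Chain⇒≡ {x} {y} c@(x<y , x≡y) with m≤n⇒∃[o]m+o≡n (Chain⇒< c)
  ... | m , eq = m , (begin
    y                                        ≡⟨ m≡m%n+[m/n]*n y e ⟩
    y % e + (y ℕ./ e) * e                    ≡⟨ cong₂ (λ r q → r + q * e) (sym x≡y) (trans (sym eq) (sym (+-suc (x ℕ./ e) m))) ⟩
    x % e + (x ℕ./ e + suc m) * e            ≡⟨ cong (_+_ (x % e)) (*-distribʳ-+ e (x ℕ./ e) (suc m)) ⟩
    x % e + ((x ℕ./ e) * e + suc m * e)      ≡⟨ +-assoc (x % e) _ _ ⟨
    x % e + (x ℕ./ e) * e + suc m * e        ≡⟨ cong (_+ suc m * e) (m≡m%n+[m/n]*n x e) ⟨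
    x + suc m * e                            ∎)
    where open ≡-Reasoning

  ≡⇒Chain : ∀ {x y} m → y ≡ x + suc m * e → Chain e x y
  ≡⇒Chain {x} m refl = m<m+n x (m≤n⇒m≤n+o (m * e) (>-nonZero⁻¹ e)) , sym ([m+kn]%n≡m%n x (suc m) e)

  -- Each counted `y` equals `a + suc i * e` for some `i < p`, and each `i` accounts for at most one
  -- position. Counting the pairs `(i , y)` in both orders gives the bound.
  count-chain : ∀ {n} a p → sum {n} (λ y → 𝟙 (chain? e a (toℕ y) ×-dec toℕ y <? a + suc p * e)) ≤ p
  count-chain {n} a p = begin
    sum {n} (λ y → 𝟙 (R? y))
      ≤⟨ sum-mono (λ y → 𝟙≤count (λ i → at? i y) (R? y) (index y)) ⟩
    sum (λ y → sum (λ i → 𝟙 (at? i y)))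
      ≡⟨ ∑-comm (λ y i → 𝟙 (at? i y)) ⟩
    sum (λ i → sum (λ y → 𝟙 (at? i y)))
      ≤⟨ sum-mono (λ i → count≤𝟙 (at? i) (yes tt) (λ _ → tt)
           λ eq eq′ → Finₚ.toℕ-injective (trans eq (sym eq′))) ⟩
    sum {p} (λ _ → 1)
      ≡⟨ trans (sum-const p 1) (*-identityʳ p) ⟩
    p ∎
    where
    open ≤-Reasoning
    R? : (y : Fin n) → Dec (Chain e a (toℕ y) × toℕ y < a + suc p * e)
    R? y = chain? e a (toℕ y) ×-dec toℕ y <? a + suc p * e
    at? : (i : Fin p) (y : Fin n) → Dec (toℕ y ≡ a + suc (toℕ i) * e)
    at? i y = toℕ y ≟ a + suc (toℕ i) * e
    index : ∀ y → Chain e a (toℕ y) × toℕ y < a + suc p * e → ∃ λ (i : Fin p) → toℕ y ≡ a + suc (toℕ i) * e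
    index y (c , y<) with Chain⇒≡ c
    ... | m , eq = fromℕ< m<p , trans eq (cong (λ i → a + suc i * e) (sym (Finₚ.toℕ-fromℕ< m<p)))
      where m<p = s<s⁻¹ (*-cancelʳ-< e (suc m) (suc p) (+-cancelˡ-< a _ _ (subst (_< a + suc p * e) eq y<)))

inversion? : ∀ e .{{_ : NonZero e}} {n} (xs : Vec (Fin n) n) x y →
             Dec (Chain e (toℕ x) (toℕ y) × lookup xs y Fin.< lookup xs x)
inversion? e xs x y = chain? e (toℕ x) (toℕ y) ×-dec lookup xs y Finₚ.<? lookup xs x

inversions : ∀ e .{{_ : NonZero e}} {n} → Vec (Fin n) n → ℕ
inversions e xs = sum₂ (λ x y → 𝟙 (inversion? e xs x y))

-- Pairs that an exchange of a and b disorders share a position with {a , b}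
-- and have the other one between a and b.
transposed-chain : ∀ {e} .{{_ : NonZero e}} {n} {a b x y x′ y′ : Fin n} →
  Chain e (toℕ a) (toℕ b) → Transposed a b x x′ → Transposed a b y y′ → Chain e (toℕ x) (toℕ y) →
  Chain e (toℕ x′) (toℕ y′) ⊎
  (x ≡ a × Chain e (toℕ a) (toℕ y) × toℕ y ≤ toℕ b) ⊎ (y ≡ b × Chain e (toℕ a) (toℕ x) × toℕ x < toℕ b)
transposed-chain {a = a} {b} {x} {y} (a<b , a≡b) X Y c@(x<y , x≡y) with X | Y
... | first refl  | first refl  = contradiction x<y (<-irrefl refl)
... | first refl  | second refl = inj₂ (inj₁ (refl , c , ≤-refl))
... | second refl | first refl  = contradiction x<y (<-asym a<b)
... | second refl | second refl = contradiction x<y (<-irrefl refl)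
... | second refl | fixed _ _   = inj₁ (<-trans a<b x<y , trans a≡b x≡y)
... | fixed _ _   | first refl  = inj₁ (<-trans x<y a<b , trans x≡y a≡b)
... | fixed _ _   | fixed _ _   = inj₁ c
... | first refl  | fixed _ _ with toℕ y ≤? toℕ b
...   | yes y≤b = inj₂ (inj₁ (refl , c , y≤b))
...   | no  y≰b = inj₁ (≰⇒> y≰b , trans (sym a≡b) x≡y)
transposed-chain {a = a} {b} {x} {y} (a<b , a≡b) X Y c@(x<y , x≡y)
    | fixed x≢a _ | second refl with <-cmp (toℕ x) (toℕ a)
...   | tri< x<a _ _ = inj₁ (x<a , trans x≡y (sym a≡b))
...   | tri≈ _ x≡a _ = contradiction (Finₚ.toℕ-injective x≡a) x≢a
...   | tri> _ _ a<x = inj₂ (inj₂ (refl , (a<x , trans a≡b (sym x≡y)) , x<y))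

-- Keys travel with the transposition `τ`, so an inverted pair `(x , y)` becomes the inverted pair
-- `(τ x , τ y)` unless its positions are disordered. The exceptions are `(a , y)` with `a < y ≤ b`,
-- at most `suc p` of them, and `(x , b)` with `a < x < b`, at most `p`.
inversions-exchange : ∀ {e} .{{_ : NonZero e}} {n} p {a b : Fin n} (xs : Vec (Fin n) n) →
  toℕ b ≡ toℕ a + suc p * e → inversions e xs ≤ inversions e (exchange a b xs) + (p + suc p)
inversions-exchange {e} {n} p {a} {b} xs b≡ = begin
  inversions e xs
    ≤⟨ sum₂-mono (λ x y → ≤-trans
         (𝟙-⊎ (inversion? e xs x y) (inversion? e xs′ (τ x) (τ y)) (A? x y ⊎-dec B? x y) (split x y))
         (+-monoʳ-≤ (𝟙 (inversion? e xs′ (τ x) (τ y))) (𝟙-⊎ (A? x y ⊎-dec B? x y) (A? x y) (B? x y) id))) ⟩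
  sum₂ (λ x y → F x y + (𝟙 (A? x y) + 𝟙 (B? x y)))
    ≡⟨ trans (sum₂-distrib-+ F _) (cong (_+_ (sum₂ F)) (sum₂-distrib-+ (λ x y → 𝟙 (A? x y)) (λ x y → 𝟙 (B? x y)))) ⟩
  sum₂ F + (sum₂ (λ x y → 𝟙 (A? x y)) + sum₂ (λ x y → 𝟙 (B? x y)))
    ≤⟨ +-mono-≤ (≤-reflexive (sym (sum₂-permute (λ x y → 𝟙 (inversion? e xs′ x y)) (Permutation.transpose a b))))
                (+-mono-≤ A≤ B≤) ⟩
  inversions e xs′ + (suc p + p)
    ≡⟨ cong (_+_ (inversions e xs′)) (+-comm (suc p) p) ⟩
  inversions e xs′ + (p + suc p) ∎
  where
  open ≤-Reasoning
  xs′ = exchange a b xs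
  τ   = Components.transpose a b
  F : Fin n → Fin n → ℕ
  F x y = 𝟙 (inversion? e xs′ (τ x) (τ y))
  c : Chain e (toℕ a) (toℕ b)
  c = ≡⇒Chain p b≡
  a≢b : a ≢ b
  a≢b refl = <-irrefl refl (proj₁ c)
  R? : ∀ k y → Dec (Chain e (toℕ a) (toℕ y) × toℕ y < toℕ a + suc k * e)
  R? k y = chain? e (toℕ a) (toℕ y) ×-dec toℕ y <? toℕ a + suc k * e
  -- The pair `(a , b)` is charged here: the range is one step of `e` longer than that of `B?`, so
  -- that it includes `b` itself.
  A? : ∀ x y → Dec (x ≡ a × Chain e (toℕ a) (toℕ y) × toℕ y < toℕ a + suc (suc p) * e)
  A? x y = x Finₚ.≟ a ×-dec R? (suc p) y
  B? : ∀ x y → Dec (y ≡ b × Chain e (toℕ a) (toℕ x) × toℕ x < toℕ a + suc p * e)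
  B? x y = y Finₚ.≟ b ×-dec R? p x
  split : ∀ x y → Chain e (toℕ x) (toℕ y) × lookup xs y Fin.< lookup xs x →
    (Chain e (toℕ (τ x)) (toℕ (τ y)) × lookup xs′ (τ y) Fin.< lookup xs′ (τ x)) ⊎
    ((x ≡ a × Chain e (toℕ a) (toℕ y) × toℕ y < toℕ a + suc (suc p) * e) ⊎
     (y ≡ b × Chain e (toℕ a) (toℕ x) × toℕ x < toℕ a + suc p * e))
  split x y (xy , inv) with transposed-chain c (transposed a b x) (transposed a b y) xy
  ... | inj₁ xy′ = inj₁ (xy′ , subst₂ Fin._<_ (sym (lookup-exchange-transposed a≢b xs (transposed a b y)))
                                              (sym (lookup-exchange-transposed a≢b xs (transposed a b x))) inv)
  ... | inj₂ (inj₁ (x≡a , ay , y≤b)) = inj₂ (inj₁ (x≡a , ay , ≤-<-trans y≤b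
          (subst (_< toℕ a + suc (suc p) * e) (sym b≡) (+-monoʳ-< (toℕ a) (*-monoˡ-< e (n<1+n (suc p)))))))
  ... | inj₂ (inj₂ (y≡b , ax , x<b)) = inj₂ (inj₂ (y≡b , ax , subst (toℕ x <_) b≡ x<b))
  A≤ : sum₂ (λ x y → 𝟙 (A? x y)) ≤ suc p
  A≤ = begin
    sum₂ (λ x y → 𝟙 (A? x y))               ≡⟨ ∑-comm (λ x y → 𝟙 (A? x y)) ⟩
    sum (λ y → sum (λ x → 𝟙 (A? x y)))      ≤⟨ sum-mono (λ y → count≤𝟙 (λ x → A? x y) (R? (suc p) y) proj₂
                                                 λ (x≡a , _) (x′≡a , _) → trans x≡a (sym x′≡a)) ⟩
    sum (λ y → 𝟙 (R? (suc p) y))            ≤⟨ count-chain {n = n} (toℕ a) (suc p) ⟩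
    suc p                                   ∎
  B≤ : sum₂ (λ x y → 𝟙 (B? x y)) ≤ p
  B≤ = begin
    sum₂ (λ x y → 𝟙 (B? x y))               ≤⟨ sum-mono (λ x → count≤𝟙 (λ y → B? x y) (R? p x) proj₂
                                                 λ (y≡b , _) (y′≡b , _) → trans y≡b (sym y′≡b)) ⟩
    sum (λ x → 𝟙 (R? p x))                  ≤⟨ count-chain {n = n} (toℕ a) p ⟩
    p                                       ∎

-- Passes

-- An induction principle for passes: a preorder on states that respects a failed comparison and a
-- single exchange of out-of-order neighbours on the chain relates the states before and after the
-- whole run. Every later fact about the effect of a pass that needs only single steps is an
-- instance.
record Monotone {n} (g r : ℕ) (_≼_ : State n → State n → Set) : Set where
  field
    reflexive  : ∀ {s} → s ≼ s
    transitive : ∀ {s t u} → s ≼ t → t ≼ u → s ≼ u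
    comparison : ∀ xs e c → state xs e c ≼ state xs e (suc c)
    exchanging : ∀ {a b} k xs e c → toℕ a ≡ r + k * g → toℕ b ≡ r + suc k * g →
                 lookup xs b Fin.< lookup xs a → state xs e c ≼ state (exchange a b xs) (suc e) (suc c)

module _ {n g r : ℕ} {_≼_ : State n → State n → Set} (mono : Monotone g r _≼_) where
  open Monotone mono

  sift-≼ : ∀ k .(b : r + k * g < n) s → s ≼ sift g r k b s
  sift-≼ zero    b s = reflexive
  sift-≼ (suc k) b (state xs e c)
    with lookup xs (fromℕ< b) Finₚ.<? lookup xs (fromℕ< (predecessor< g r k b))
  ... | yes xb<xa = transitive
          (exchanging k xs e c (Finₚ.toℕ-fromℕ< (predecessor< g r k b)) (Finₚ.toℕ-fromℕ< b) xb<xa)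
          (sift-≼ k (predecessor< g r k b) _)
  ... | no _      = comparison xs e c

  sortChainUpTo-≼ : ∀ k s → s ≼ sortChainUpTo g r k s
  sortChainUpTo-≼ zero    s = reflexive
  sortChainUpTo-≼ (suc k) s with r + k * g <? n
  ... | yes b = transitive (sortChainUpTo-≼ k s) (sift-≼ k b _)
  ... | no  _ = sortChainUpTo-≼ k s

pass-≼ : ∀ {n g} {_≼_ : State n → State n → Set} → (∀ r → Monotone g r _≼_) → ∀ s → s ≼ pass s g
pass-≼ {n} {g} {_≼_} mono s = go (List.upTo g) s
  where
  go : ∀ rs s → s ≼ List.foldl (λ s r → sortChain g r s) s rs
  go []       s = Monotone.reflexive (mono 0)
  go (r ∷ rs) s = Monotone.transitive (mono r) (sortChainUpTo-≼ (mono r) n s) (go rs (sortChain g r s))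

foldl-pass-≼ : ∀ {n} {_≼_ : State n → State n → Set} → (∀ g r → Monotone g r _≼_) →
               ∀ {k} (gaps : Vector ℕ k) s → s ≼ Vector.foldl pass s gaps
foldl-pass-≼ mono {zero}  gaps s = Monotone.reflexive (mono 0 0)
foldl-pass-≼ mono {suc k} gaps s = Monotone.transitive (mono 0 0)
  (pass-≼ (mono (gaps zero)) s) (foldl-pass-≼ mono (gaps ∘ suc) (pass s (gaps zero)))

exchanges-mono : ∀ {n} g r → Monotone {n} g r (λ s t → exchanges s ≤ exchanges t)
exchanges-mono g r = record
  { reflexive  = ≤-refl
  ; transitive = ≤-trans
  ; comparison = λ _ _ _ → ≤-refl
  ; exchanging = λ _ _ e _ _ _ _ → n≤1+n e
  }

-- An invariant of one state becomes a preorder on states by taking the implication from the earlier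
-- state to the later one.
exchanges≤comparisons-mono : ∀ {n} g r →
  Monotone {n} g r (λ s t → exchanges s ≤ comparisons s → exchanges t ≤ comparisons t)
exchanges≤comparisons-mono g r = record
  { reflexive  = id
  ; transitive = λ f g → g ∘ f
  ; comparison = λ _ _ _ → m≤n⇒m≤1+n
  ; exchanging = λ _ _ _ _ _ _ _ → s≤s
  }

exchanges≤comparisons : ∀ {q n} (H : GapSequence q) (xs : Vec (Fin n) n) →
                        exchanges (shellsort H xs) ≤ comparisons (shellsort H xs)
exchanges≤comparisons H xs = foldl-pass-≼ exchanges≤comparisons-mono (GapSequence.h H) (state xs 0 0) z≤n

Sorted : ∀ g .{{_ : NonZero g}} {n} → Vec (Fin n) n → Set
Sorted g xs = ∀ {x y} → Chain g (toℕ x) (toℕ y) → lookup xs x Fin.≤ lookup xs y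

module _ {g : ℕ} .{{_ : NonZero g}} where

  position< : ∀ r k {a b} → a ≡ r + k * g → b ≡ r + suc k * g → b ≡ a + g
  position< r k refl refl = trans (cong (_+_ r) (+-comm g (k * g))) (sym (+-assoc r (k * g) g))

  -- An exchange would require an out-of-order pair at distance `g`, which sortedness forbids. The
  -- equality of keys is carried along so that sortedness reaches the next step.
  idle-mono : ∀ {n} r → Monotone {n} g r (λ s t → Sorted g (keys s) → keys t ≡ keys s × exchanges t ≡ exchanges s)
  idle-mono r = record
    { reflexive  = λ _ → refl , refl
    ; transitive = λ f g srt → let (k , e) = f srt ; (k′ , e′) = g (subst (Sorted _) (sym k) srt)
                               in trans k′ k , trans e′ e
    ; comparison = λ _ _ _ _ → refl , refl
    ; exchanging = λ k xs _ _ a≡ b≡ xb<xa srt → contradiction xb<xa (≤⇒≯ (srt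
        (≡⇒Chain 0 (trans (position< r k a≡ b≡) (cong (_+_ _) (sym (*-identityˡ g)))))))
    }

  sorted-idle : ∀ {n} (s : State n) → Sorted g (keys s) →
                keys (pass s g) ≡ keys s × exchanges (pass s g) ≡ exchanges s
  sorted-idle = pass-≼ idle-mono

-- An exchange at distance p′ e removes at most 2 p′ ∸ 1 inversions along the
-- e-chains; here p′ = suc p.
Costs : ℕ → ℕ → ℕ → Set
Costs e c g = ∃ λ p → g ≡ suc p * e × p + suc p ≤ c

module _ {e : ℕ} .{{_ : NonZero e}} {c g : ℕ} where

  -- A potential argument: an exchange lowers the number of inversions by at most `c` and raises the
  -- other summand by exactly `c`.
  credit-mono : ∀ {n} → Costs e c g → ∀ r → Monotone {n} g r
    (λ s t → inversions e (keys s) + c * exchanges s ≤ inversions e (keys t) + c * exchanges t)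
  credit-mono (p , refl , p+1+p≤c) r = record
    { reflexive  = ≤-refl
    ; transitive = ≤-trans
    ; comparison = λ _ _ _ → ≤-refl
    ; exchanging = λ {a} {b} k xs ex _ a≡ b≡ _ → begin
        inversions e xs + c * ex
          ≤⟨ +-monoˡ-≤ (c * ex) (inversions-exchange p xs (step k a≡ b≡)) ⟩
        inversions e (exchange a b xs) + (p + suc p) + c * ex
          ≤⟨ +-monoˡ-≤ (c * ex) (+-monoʳ-≤ (inversions e (exchange a b xs)) p+1+p≤c) ⟩
        inversions e (exchange a b xs) + c + c * ex
          ≡⟨ trans (+-assoc (inversions e (exchange a b xs)) c (c * ex))
                   (cong (_+_ (inversions e (exchange a b xs))) (sym (*-suc c ex))) ⟩
        inversions e (exchange a b xs) + c * suc ex ∎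
    }
    where
    open ≤-Reasoning
    step : ∀ k {x y} → x ≡ r + k * (suc p * e) → y ≡ r + suc k * (suc p * e) → y ≡ x + suc p * e
    step k = position< {suc p * e} {{m*n≢0 (suc p) e}} r k

-- Insertion sort

SortedChain : ∀ {n} (g r K : ℕ) → Vec (Fin n) n → Set
SortedChain g r K xs = ∀ {i j x y} → i < j → j < K → toℕ x ≡ r + i * g → toℕ y ≡ r + j * g →
                       lookup xs x Fin.≤ lookup xs y

-- Only the key at index k may be smaller than keys before it.
SortedChainExcept : ∀ {n} (g r K k : ℕ) → Vec (Fin n) n → Set
SortedChainExcept g r K k xs = ∀ {i j x y} → i < j → j < K → j ≢ k → toℕ x ≡ r + i * g → toℕ y ≡ r + j * g →
                               lookup xs x Fin.≤ lookup xs y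

module _ {g : ℕ} .{{_ : NonZero g}} {n : ℕ} where

  same-index : ∀ r i {j} {x y : Fin n} → toℕ x ≡ r + i * g → toℕ y ≡ r + j * g → i ≡ j → x ≡ y
  same-index _ _ x≡ y≡ refl = Finₚ.toℕ-injective (trans x≡ (sym y≡))

  other-index : ∀ r i j {x y : Fin n} → toℕ x ≡ r + i * g → toℕ y ≡ r + j * g → i ≢ j → x ≢ y
  other-index r i j x≡ y≡ i≢j refl =
    i≢j (*-cancelʳ-≡ i j g (+-cancelˡ-≡ r _ _ (trans (sym x≡) y≡)))

  -- The exception follows the sifted key from index `suc k` down to `k`; the larger key that takes
  -- its old place was already in order with everything else.
  exchange-sortedExcept : ∀ {r K k a b} (xs : Vec (Fin n) n) →
    toℕ a ≡ r + k * g → toℕ b ≡ r + suc k * g → suc k < K → lookup xs b Fin.< lookup xs a →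
    SortedChainExcept g r K (suc k) xs → SortedChainExcept g r K k (exchange a b xs)
  exchange-sortedExcept {r} {K} {k} {a} {b} xs a≡ b≡ k<K xb<xa srt {i} {j} {x} {y} i<j j<K j≢k x≡ y≡ =
    subst₂ Fin._≤_ (sym (proj₂ X)) (sym (proj₂ Y)) (compare (proj₁ X) (proj₁ Y))
    where
    a≢b : a ≢ b
    a≢b = other-index r k (suc k) a≡ b≡ (<⇒≢ (n<1+n k))

    data Value i (x : Fin n) : Fin n → Set where
      old : i ≢ k → i ≢ suc k → Value i x (lookup xs x)
      at-a : i ≡ k     → Value i x (lookup xs b)
      at-b : i ≡ suc k → Value i x (lookup xs a)

    value : ∀ i x → toℕ x ≡ r + i * g → ∃ λ v → Value i x v × lookup (exchange a b xs) x ≡ v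
    value i x x≡ with i ≟ k
    ... | yes i≡k = _ , at-a i≡k ,
      trans (cong (lookup (exchange a b xs)) (same-index r i x≡ a≡ i≡k)) (lookup-exchangeˡ a≢b xs)
    ... | no i≢k with i ≟ suc k
    ...   | yes i≡1+k = _ , at-b i≡1+k ,
      trans (cong (lookup (exchange a b xs)) (same-index r i x≡ b≡ i≡1+k)) (lookup-exchangeʳ a≢b xs)
    ...   | no  i≢1+k = _ , old i≢k i≢1+k ,
              lookup-exchange-other a≢b xs (other-index r i k x≡ a≡ i≢k) (other-index r i (suc k) x≡ b≡ i≢1+k)

    X = proj₂ (value i x x≡)
    Y = proj₂ (value j y y≡)

    compare : ∀ {u v} → Value i x u → Value j y v → u Fin.≤ v
    compare _            (at-a j≡k)     = contradiction j≡k j≢k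
    compare (old i≢k _)  (at-b refl)    = srt (≤∧≢⇒< (s≤s⁻¹ i<j) i≢k) (<-trans (n<1+n k) k<K) (<⇒≢ (n<1+n k)) x≡ a≡
    compare (at-a _)     (at-b _)       = <⇒≤ xb<xa
    compare (at-b refl)  (at-b refl)    = contradiction i<j (<-irrefl refl)
    compare (old _ _)    (old _ j≢1+k)  = srt i<j j<K j≢1+k x≡ y≡
    -- The exception concerns only the later index of a pair, so the sifted key, formerly at
    -- `suc k`, is known to be at most every key after it.
    compare (at-a refl)  (old _ j≢1+k)  = srt (≤∧≢⇒< i<j (j≢1+k ∘ sym)) j<K j≢1+k b≡ y≡
    compare (at-b refl)  (old _ j≢1+k)  = srt (<-trans (n<1+n k) i<j) j<K j≢1+k a≡ y≡

  sift-sorts : ∀ {r K} k .(b : r + k * g < n) s → k < K →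
               SortedChainExcept g r K k (keys s) → SortedChain g r K (keys (sift g r k b s))
  -- Nothing stands before index 0, so an exception there is vacuous.
  sift-sorts zero    b s _ srt i<j j<K = srt i<j j<K (<⇒≢ (≤-<-trans z≤n i<j) ∘ sym)
  sift-sorts {r} {K} (suc k) b (state xs e c) k<K srt
    with lookup xs (fromℕ< b) Finₚ.<? lookup xs (fromℕ< (predecessor< g r k b))
  ... | yes xb<xa = sift-sorts k _ _ (<-trans (n<1+n k) k<K)
          (exchange-sortedExcept xs (Finₚ.toℕ-fromℕ< (predecessor< g r k b)) (Finₚ.toℕ-fromℕ< b) k<K xb<xa srt)
  ... | no  xb≮xa = sorted
    where
    sorted : SortedChain g r K xs
    sorted {i} {j} {x} {y} i<j j<K x≡ y≡ with j ≟ suc k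
    ... | no  j≢1+k = srt i<j j<K j≢1+k x≡ y≡
    ... | yes refl with same-index r j y≡ (Finₚ.toℕ-fromℕ< b) refl | i ≟ k
    ...   | refl | yes i≡k with same-index r i x≡ (Finₚ.toℕ-fromℕ< (predecessor< g r k b)) i≡k
    ...     | refl = ≮⇒≥ xb≮xa
    -- Sifting stopped at `suc k`: its key is at least the one at `k`, which in turn bounds all
    -- earlier keys.
    sorted {i} {j} {x} {y} i<j j<K x≡ y≡
        | yes refl | refl | no i≢k = ≤-trans
          (srt (≤∧≢⇒< (s≤s⁻¹ i<j) i≢k) (<-trans (n<1+n k) k<K) (<⇒≢ (n<1+n k)) x≡ (Finₚ.toℕ-fromℕ< (predecessor< g r k b)))
          (≮⇒≥ xb≮xa)

  sortChainUpTo-sorts : ∀ r K (s : State n) → SortedChain g r K (keys (sortChainUpTo g r K s))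
  sortChainUpTo-sorts r zero    s i<j ()
  sortChainUpTo-sorts r (suc K) s {j = j} {y = y} i<j j<1+K x≡ y≡ with r + K * g <? n
  ... | yes b = sift-sorts K b (sortChainUpTo g r K s) (n<1+n K)
          (λ i<j j<1+K j≢K → sortChainUpTo-sorts r K s i<j (≤∧≢⇒< (s≤s⁻¹ j<1+K) j≢K)) i<j j<1+K x≡ y≡
  -- Index `K` falls outside the array, so no position `y` has it and `j` is below `K`.
  ... | no ¬b = sortChainUpTo-sorts r K s i<j (≤∧≢⇒< (s≤s⁻¹ j<1+K) j≢K) x≡ y≡
    where
    j≢K : j ≢ K
    j≢K refl = ¬b (subst (_< n) y≡ (Finₚ.toℕ<n y))

  OffChain : ℕ → Fin n → Set
  OffChain r x = ∀ k → toℕ x ≢ r + k * g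

  off-chain-mono : ∀ r → Monotone {n} g r (λ s t → ∀ {x} → OffChain r x → lookup (keys t) x ≡ lookup (keys s) x)
  off-chain-mono r = record
    { reflexive  = λ _ → refl
    ; transitive = λ f g off → trans (g off) (f off)
    ; comparison = λ _ _ _ _ → refl
    ; exchanging = λ k xs _ _ a≡ b≡ xb<xa off → lookup-exchange-other
        (other-index r k (suc k) a≡ b≡ (<⇒≢ (n<1+n k))) xs
        (λ { refl → off k a≡ }) (λ { refl → off (suc k) b≡ })
    }

  residue-unique : ∀ {r r′} i j → r < g → r′ < g → r + i * g ≡ r′ + j * g → r ≡ r′
  residue-unique {r} {r′} i j r<g r′<g eq = begin
    r                ≡⟨ m<n⇒m%n≡m r<g ⟨
    r % g            ≡⟨ [m+kn]%n≡m%n r i g ⟨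
    (r + i * g) % g  ≡⟨ cong (_% g) eq ⟩
    (r′ + j * g) % g ≡⟨ [m+kn]%n≡m%n r′ j g ⟩
    r′ % g           ≡⟨ m<n⇒m%n≡m r′<g ⟩
    r′               ∎
    where open ≡-Reasoning

  sortChain-preserves : ∀ {r r′} (s : State n) → r < g → r′ < g →
    SortedChain g r n (keys s) → SortedChain g r n (keys (sortChain g r′ s))
  sortChain-preserves {r} {r′} s r<g r′<g srt {i} {j} {x} {y} i<j j<n x≡ y≡ with r ≟ r′
  ... | yes refl = sortChainUpTo-sorts r n s i<j j<n x≡ y≡
  ... | no  r≢r′ = subst₂ Fin._≤_ (sym (unchanged {i} x≡)) (sym (unchanged {j} y≡)) (srt i<j j<n x≡ y≡)
    where
    unchanged : ∀ {i x} → toℕ x ≡ r + i * g → lookup (keys (sortChain g r′ s)) x ≡ lookup (keys s) x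
    unchanged {i} x≡ = sortChainUpTo-≼ (off-chain-mono r′) n s
      λ k x≡′ → r≢r′ (residue-unique i k r<g r′<g (trans (sym x≡) x≡′))

  -- The disjunction is the loop invariant: chain `r` is either still to be processed or already
  -- sorted, and work on other chains does not disturb it.
  chains-sort : ∀ {r} → r < g → ∀ rs → All (_< g) rs → ∀ s → r ∈ rs ⊎ SortedChain g r n (keys s) →
                SortedChain g r n (keys (List.foldl (λ s r → sortChain g r s) s rs))
  chains-sort r<g []       []           s (inj₂ srt) = srt
  chains-sort r<g (_ ∷ rs) (_ ∷ rs<g)    s (inj₁ (here refl)) =
    chains-sort r<g rs rs<g _ (inj₂ (sortChainUpTo-sorts _ n s))
  chains-sort r<g (_ ∷ rs) (_ ∷ rs<g)    s (inj₁ (there r∈rs)) =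
    chains-sort r<g rs rs<g _ (inj₁ r∈rs)
  chains-sort r<g (_ ∷ rs) (r′<g ∷ rs<g) s (inj₂ srt) =
    chains-sort r<g rs rs<g _ (inj₂ (sortChain-preserves s r<g r′<g srt))

  pass-sorts : ∀ (s : State n) → Sorted g (keys (pass s g))
  pass-sorts s {x} {y} c = chains-sort (m%n<n (toℕ x) g) (List.upTo g) (Allₚ.all-upTo g) s
    (inj₁ (∈ₚ.∈-upTo⁺ (m%n<n (toℕ x) g)))
    -- The index of `y` on its chain is `toℕ y / g`, at most `toℕ y` and so below the `n` insertions
    -- that `sortChain` makes.
    (Chain⇒< c) (≤-<-trans (m/n≤m (toℕ y) g) (Finₚ.toℕ<n y))
    (m≡m%n+[m/n]*n (toℕ x) g)
    (trans (m≡m%n+[m/n]*n (toℕ y) g) (cong (_+ (toℕ y ℕ./ g) * g) (sym (proj₂ c))))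

  sorted⇒no-inversions : ∀ (xs : Vec (Fin n) n) → Sorted g xs → inversions g xs ≡ 0
  sorted⇒no-inversions xs srt = n≤0⇒n≡0 (begin
    inversions g xs       ≤⟨ sum₂-mono (λ x y → 𝟙-mono (inversion? g xs x y) (no id) λ (c , inv) → ≤⇒≯ (srt c) inv) ⟩
    sum₂ {n} {n} (λ _ _ → 0)
      ≡⟨ trans (sum-cong-≗ {n} (λ _ → trans (sum-const n 0) (*-zeroʳ n))) (trans (sum-const n 0) (*-zeroʳ n)) ⟩
    0                     ∎)
    where open ≤-Reasoning

-- The passes fall into three stages. Those before `i` are idle; those from `i` to `l` pay `c` per
-- exchange for the inversions they remove, and pass `l`, of gap `e`, leaves none; later passes can
-- only add exchanges.
inversions≤exchanges : ∀ {n e} .{{_ : NonZero e}} {c k} (gaps : Vector ℕ k) (positive : ∀ j → NonZero (gaps j))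
  (i : ℕ) (l : Fin k) (s : State n) →
  (∀ j → toℕ j < i → Sorted (gaps j) {{positive j}} (keys s)) →
  (∀ j → i ≤ toℕ j → j Fin.≤ l → Costs e c (gaps j)) →
  i ≤ toℕ l → gaps l ≡ e →
  inversions e (keys s) + c * exchanges s ≤ c * exchanges (Vector.foldl pass s gaps)
inversions≤exchanges {n} {e} {c} gaps positive zero zero s sorted costs i≤l refl = begin
  inversions e (keys s) + c * exchanges s
    ≤⟨ pass-≼ (credit-mono (costs zero z≤n z≤n)) s ⟩
  inversions e (keys (pass s e)) + c * exchanges (pass s e)
    ≡⟨ cong (_+ c * exchanges (pass s e))
         (sorted⇒no-inversions (keys (pass s e)) (λ {x} {y} → pass-sorts s {x} {y})) ⟩
  c * exchanges (pass s e)
    ≤⟨ *-monoʳ-≤ c (foldl-pass-≼ exchanges-mono (gaps ∘ suc) (pass s e)) ⟩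
  c * exchanges (Vector.foldl pass s gaps) ∎
  where open ≤-Reasoning
inversions≤exchanges {n} {e} {c} gaps positive zero (suc l) s sorted costs _ l≡e = begin
  inversions e (keys s) + c * exchanges s
    ≤⟨ pass-≼ (credit-mono (costs zero z≤n z≤n)) s ⟩
  inversions e (keys (pass s (gaps zero))) + c * exchanges (pass s (gaps zero))
    ≤⟨ inversions≤exchanges (gaps ∘ suc) (positive ∘ suc) zero l (pass s (gaps zero))
         (λ _ ()) (λ j _ j≤l → costs (suc j) z≤n (s≤s j≤l)) z≤n l≡e ⟩
  c * exchanges (Vector.foldl pass s gaps) ∎
  where open ≤-Reasoning
inversions≤exchanges {n} {e} {c} gaps positive (suc i) (suc l) s sorted costs (s≤s i≤l) l≡e =
  subst₂ (λ xs ex → inversions e xs + c * ex ≤ c * exchanges (Vector.foldl pass s gaps)) keys≡ exchanges≡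
    (inversions≤exchanges (gaps ∘ suc) (positive ∘ suc) i l (pass s (gaps zero))
      (λ j j<i → subst (λ xs → Sorted (gaps (suc j)) {{positive (suc j)}} xs) (sym keys≡) (sorted (suc j) (s≤s j<i)))
      (λ j i≤j j≤l → costs (suc j) (s≤s i≤j) (s≤s j≤l)) i≤l l≡e)
  where
  idle = sorted-idle {{positive zero}} s (sorted zero (s≤s z≤n))
  keys≡ = proj₁ idle
  exchanges≡ = proj₂ idle

-- Inputs with prescribed order

module _ {n : ℕ} (κ : Fin n → ℕ) where

  rank : ℕ → ℕ
  rank N = sum (λ z → 𝟙 (κ z <? N))

  rank≤n : ∀ N → rank N ≤ n
  rank≤n N = begin
    rank N          ≤⟨ sum-mono (λ z → 𝟙-mono (κ z <? N) (yes tt) _) ⟩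
    sum {n} (λ _ → 1) ≡⟨ trans (sum-const n 1) (*-identityʳ n) ⟩
    n               ∎
    where open ≤-Reasoning

  rank-< : ∀ {a N} → κ a < N → rank (κ a) < rank N
  rank-< {a} {N} κa<N = begin
    suc (rank (κ a))
      ≤⟨ +-monoˡ-≤ (rank (κ a)) (𝟙≤count (Finₚ._≟ a) (yes tt) (λ _ → a , refl)) ⟩
    sum (λ z → 𝟙 (z Finₚ.≟ a)) + rank (κ a)
      ≡⟨ ∑-distrib-+ (λ z → 𝟙 (z Finₚ.≟ a)) (λ z → 𝟙 (κ z <? κ a)) ⟨
    sum (λ z → 𝟙 (z Finₚ.≟ a) + 𝟙 (κ z <? κ a))
      ≤⟨ sum-mono (λ z → 𝟙-disjoint (z Finₚ.≟ a) (κ z <? κ a) (κ z <? N)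
           (λ { refl → κa<N }) (λ κz<κa → <-trans κz<κa κa<N) (λ { refl → <-irrefl refl })) ⟩
    rank N ∎
    where open ≤-Reasoning

  -- Realises the order of arbitrary weights `κ` by keys in `Fin n`: each position receives its
  -- rank, which stays below `n` because the position itself is counted in `rank (suc (κ a))`.
  arrangement : Vec (Fin n) n
  arrangement = Vec.tabulate λ a → fromℕ< (<-≤-trans (rank-< (n<1+n (κ a))) (rank≤n (suc (κ a))))

  arrangement-mono : ∀ {a b} → κ a < κ b → lookup arrangement a Fin.< lookup arrangement b
  arrangement-mono {a} {b} κa<κb = subst₂ _<_ (sym (key a)) (sym (key b)) (rank-< κa<κb)
    where
    key : ∀ a → toℕ (lookup arrangement a) ≡ rank (κ a)
    key a = trans (cong toℕ (Vecₚ.lookup∘tabulate _ a)) (Finₚ.toℕ-fromℕ< _)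

  arrangement-unique : (∀ {a b} → κ a ≡ κ b → a ≡ b) → Unique arrangement
  arrangement-unique injective = subst Unique (Vecₚ.tabulate∘lookup arrangement) (Uniqueₚ.tabulate⁺ distinct)
    where
    distinct : ∀ {a b} → lookup arrangement a ≡ lookup arrangement b → a ≡ b
    distinct {a} {b} eq with <-cmp (κ a) (κ b)
    ... | tri< κa<κb _ _ = contradiction (arrangement-mono κa<κb) (<-irrefl (cong toℕ eq))
    ... | tri≈ _ κa≡κb _ = injective κa≡κb
    ... | tri> _ _ κb<κa = contradiction (arrangement-mono κb<κa) (<-irrefl (cong toℕ (sym eq)))

-- x precedes y in the partial order of the semigroup S when y ∸ x ∈ S.  The
-- positions r + k h form a chain of that order, and level r y is the number of
-- its elements preceding y.  Ordering positions by level r, and then by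
-- position, puts x = r + k h after every y > x that it does not precede.
module _ (n : ℕ) {S : ℕ → Set} (S? : Decidable S) (S0 : S 0) where

  Precedes : ℕ → ℕ → Set
  Precedes x y = x ≤ y × S (y ∸ x)

  precedes? : ∀ x y → Dec (Precedes x y)
  precedes? x y = x ≤? y ×-dec S? (y ∸ x)

  precedes : ∀ {x y} d → y ≡ x + d → S d → Precedes x y
  precedes {x} d refl Sd = m≤m+n x d , subst S (sym (m+n∸m≡n x d)) Sd

  level : (h r : ℕ) → ℕ → ℕ
  level h r y = sum {n} (λ k → 𝟙 (precedes? (r + toℕ k * h) y))

  -- The lexicographic order coded as a number in base `n`: the position is the last digit, which
  -- makes the code injective, and the level is the leading part.
  order : (h r : ℕ) → Fin n → ℕ
  order h r x = toℕ x + level h r (toℕ x) * n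

  order-injective : ∀ h r {x y} → order h r x ≡ order h r y → x ≡ y
  order-injective h r {x} {y} eq = Finₚ.toℕ-injective (begin
    toℕ x                                     ≡⟨ mod-order x ⟨
    (order h r x % n) {{nonZero}}             ≡⟨ cong (λ m → (m % n) {{nonZero}}) eq ⟩
    (order h r y % n) {{nonZero}}             ≡⟨ mod-order y ⟩
    toℕ y                                     ∎)
    where
    open ≡-Reasoning
    nonZero : NonZero n
    nonZero = >-nonZero (≤-<-trans z≤n (Finₚ.toℕ<n x))
    mod-order : ∀ x → (order h r x % n) {{nonZero}} ≡ toℕ x
    mod-order x = trans ([m+kn]%n≡m%n (toℕ x) (level h r (toℕ x)) n {{nonZero}}) (m<n⇒m%n≡m {{nonZero}} (Finₚ.toℕ<n x))

  module _ {g : ℕ} .{{_ : NonZero g}} (S+g : ∀ {d} m → S d → S (d + m * g)) where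

    -- Whatever precedes `x` also precedes `y`, since `S` absorbs multiples of `g`. Hence the level
    -- does not drop along a `g`-chain, and the position makes the increase strict.
    order-chain : ∀ h r {x y : Fin n} → Chain g (toℕ x) (toℕ y) → order h r x < order h r y
    order-chain h r {x} {y} c@(x<y , _) = +-mono-<-≤ x<y (*-monoˡ-≤ n
      (sum-mono {n} λ k → 𝟙-mono (precedes? (r + toℕ k * h) (toℕ x)) (precedes? (r + toℕ k * h) (toℕ y)) trans-chain))
      where
      trans-chain : ∀ {p} → Precedes p (toℕ x) → Precedes p (toℕ y)
      trans-chain {p} (p≤x , Sd) with Chain⇒≡ c
      ... | m , eq = precedes (toℕ x ∸ p + suc m * g)
            (trans eq (trans (cong (_+ suc m * g) (sym (m+[n∸m]≡n p≤x))) (+-assoc p _ _))) (S+g (suc m) Sd)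

  module _ {h : ℕ} .{{_ : NonZero h}} (S+h : ∀ {d} m → S d → S (d + m * h)) where

    -- The chain through `x` consists of positions `r + k * h`. Those up to `x` precede `x`; one at
    -- or above `x` that preceded `y` would put `y ∸ x` in `S` by adding a multiple of `h`. So every
    -- chain element below `y` in the order is also below `x`, while `x` itself counts only for `x`.
    level-inverts : ∀ {x y} → x < n → x < y → ¬ S (y ∸ x) → level h (x % h) y < level h (x % h) x
    level-inverts {x} {y} x<n x<y ¬S = begin
      suc (level h r y)
        ≤⟨ +-monoˡ-≤ (level h r y) (𝟙≤count (Finₚ._≟ k₀) (yes tt) (λ _ → k₀ , refl)) ⟩
      sum (λ k → 𝟙 (k Finₚ.≟ k₀)) + level h r y
        ≡⟨ ∑-distrib-+ (λ k → 𝟙 (k Finₚ.≟ k₀)) (λ k → 𝟙 (precedes? (p k) y)) ⟨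
      sum (λ k → 𝟙 (k Finₚ.≟ k₀) + 𝟙 (precedes? (p k) y))
        ≤⟨ sum-mono (λ k → 𝟙-disjoint (k Finₚ.≟ k₀) (precedes? (p k) y) (precedes? (p k) x)
             (λ { refl → precedes 0 (trans (sym pk₀≡x) (sym (+-identityʳ _))) S0 })
             (below k)
             (λ { refl (_ , Sd) → ¬S (subst (λ x → S (y ∸ x)) pk₀≡x Sd) })) ⟩
      level h r x ∎
      where
      open ≤-Reasoning
      r = x % h
      x/h<n = ≤-<-trans (m/n≤m x h) x<n
      k₀ : Fin n
      k₀ = fromℕ< x/h<n
      p : Fin n → ℕ
      p k = r + toℕ k * h
      pk₀≡x : p k₀ ≡ x
      pk₀≡x = trans (cong (λ k → r + k * h) (Finₚ.toℕ-fromℕ< x/h<n)) (sym (m≡m%n+[m/n]*n x h))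
      climb : ∀ {i j} m → i + m ≡ j → r + j * h ≡ (r + i * h) + m * h
      climb {i} m refl = trans (cong (_+_ r) (*-distribʳ-+ h i m)) (sym (+-assoc r (i * h) (m * h)))
      below : ∀ k → Precedes (p k) y → Precedes (p k) x
      below k (p≤y , Sd) with ≤-total (toℕ k) (toℕ k₀)
      ... | inj₁ k≤k₀ with m≤n⇒∃[o]m+o≡n k≤k₀
      ...   | m , eq = precedes (m * h) (trans (sym pk₀≡x) (climb m eq)) (S+h m S0)
      below k (p≤y , Sd) | inj₂ k₀≤k with m≤n⇒∃[o]m+o≡n k₀≤k
      ...   | m , eq = contradiction (subst S (sym y∸x≡) (S+h m Sd)) ¬S
        where
        y∸x≡ : y ∸ x ≡ (y ∸ p k) + m * h
        y∸x≡ = begin-equality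
          y ∸ x                          ≡⟨ cong (_∸ x) (m+[n∸m]≡n p≤y) ⟨
          p k + (y ∸ p k) ∸ x            ≡⟨ cong (λ q → q + (y ∸ p k) ∸ x) (trans (climb m eq) (cong (_+ m * h) pk₀≡x)) ⟩
          x + m * h + (y ∸ p k) ∸ x      ≡⟨ cong (_∸ x) (+-assoc x (m * h) _) ⟩
          x + (m * h + (y ∸ p k)) ∸ x    ≡⟨ m+n∸m≡n x _ ⟩
          m * h + (y ∸ p k)              ≡⟨ +-comm (m * h) _ ⟩
          (y ∸ p k) + m * h              ∎

    order-inverts : ∀ {x y : Fin n} → toℕ x < toℕ y → ¬ S (toℕ y ∸ toℕ x) →
                    order h (toℕ x % h) y < order h (toℕ x % h) x
    order-inverts {x} {y} x<y ¬S = begin-strict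
      -- Positions are less than `n`, so one level outweighs any difference of positions.
      toℕ y + level h r (toℕ y) * n   <⟨ +-monoˡ-< (level h r (toℕ y) * n) (Finₚ.toℕ<n y) ⟩
      suc (level h r (toℕ y)) * n     ≤⟨ *-monoˡ-≤ n (level-inverts (Finₚ.toℕ<n x) x<y ¬S) ⟩
      level h r (toℕ x) * n           ≤⟨ m≤n+m _ (toℕ x) ⟩
      order h r x                     ∎
      where
      open ≤-Reasoning
      r = toℕ x % h

-- Closure properties of the semigroups

combination-0 : ∀ {k} (g : Vector ℕ k) → Combination g 0
combination-0 {k} g = (λ _ → 0) , sym (trans (sum-const k 0) (*-zeroʳ k))

combination-+ : ∀ {k} (g : Vector ℕ k) i m {d} → Combination g d → Combination g (d + m * g i)
combination-+ g zero m (x , refl) = (x zero + m) Vector.∷ Vector.tail x , (begin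
  x zero * g zero + rest + m * g zero    ≡⟨ +-assoc (x zero * g zero) rest _ ⟩
  x zero * g zero + (rest + m * g zero)  ≡⟨ cong (_+_ (x zero * g zero)) (+-comm rest _) ⟩
  x zero * g zero + (m * g zero + rest)  ≡⟨ +-assoc (x zero * g zero) _ rest ⟨
  x zero * g zero + m * g zero + rest    ≡⟨ cong (_+ rest) (*-distribʳ-+ (g zero) (x zero) m) ⟨
  (x zero + m) * g zero + rest           ∎)
  where
  open ≡-Reasoning
  rest = sum (λ i → x (suc i) * g (suc i))
combination-+ g (suc i) m (x , refl) with combination-+ (g ∘ suc) i m (x ∘ suc , refl)
... | y , eq = x zero Vector.∷ y , trans (+-assoc (x zero * g zero) _ _) (cong (_+_ (x zero * g zero)) eq)

-- Distances

sum-filter : ∀ {P : ℕ → Set} (P? : Decidable P) (f g : ℕ → ℕ) M →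
  ListAction.sum (List.map f (filter P? (applyUpTo g M))) ≡ sum {M} (λ i → 𝟙 (P? (g (toℕ i))) * f (g (toℕ i)))
sum-filter P? f g zero = refl
sum-filter P? f g (suc M) with P? (g 0)
... | yes _ = cong₂ _+_ (sym (+-identityʳ (f (g 0)))) (sum-filter P? f (g ∘ suc) M)
... | no  _ = sum-filter P? f (g ∘ suc) M

n∸d≤pairs : ∀ n d → n ∸ d ≤ sum₂ {n} {n} (λ x y → 𝟙 (toℕ y ≟ toℕ x + d))
n∸d≤pairs n d = begin
  n ∸ d
    ≤⟨ k≤count-< (m∸n≤m n d) ⟩
  sum {n} (λ x → 𝟙 (toℕ x <? n ∸ d))
    ≤⟨ sum-mono {n} (λ x → 𝟙≤count (λ y → toℕ y ≟ toℕ x + d) (toℕ x <? n ∸ d) (partner x)) ⟩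
  sum₂ {n} {n} (λ x y → 𝟙 (toℕ y ≟ toℕ x + d)) ∎
  where
  open ≤-Reasoning
  partner : ∀ x → toℕ x < n ∸ d → ∃ λ (y : Fin n) → toℕ y ≡ toℕ x + d
  partner x x<n∸d = fromℕ< x+d<n , Finₚ.toℕ-fromℕ< x+d<n
    -- Something lies below `n ∸ d`, so the subtraction is not truncated and `d ≤ n`.
    where x+d<n = m≤o∸n⇒m+n≤o (suc (toℕ x)) (<⇒≤ (m∸n≢0⇒n<m (m<n⇒n≢0 x<n∸d))) x<n∸d

module _ {e : ℕ} .{{_ : NonZero e}} {S : ℕ → Set} (S? : Decidable S) where

  gap? : ∀ x y → Dec (Chain e x y × ¬ S (y ∸ x))
  gap? x y = chain? e x y ×-dec ¬? (S? (y ∸ x))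

  -- At least `n ∸ f m` pairs are at distance `f m`, and distinct `m` give distinct distances, so no
  -- pair is counted twice. Keeping `f` general lets the left side match both `D`, with
  -- `f m = m * h j`, and `U`, with `f = id` and `e = 1`.
  distances≤pairs : ∀ n (f : ℕ → ℕ) → (∀ m → f m ≡ m * e) → ∀ M →
    ListAction.sum (List.map (λ m → n ∸ f m) (filter (λ m → ¬? (S? (f m))) [1… M ])) ≤
    sum₂ {n} {n} (λ x y → 𝟙 (gap? (toℕ x) (toℕ y)))
  distances≤pairs n f f≡ M = begin
    ListAction.sum (List.map (λ m → n ∸ f m) (filter (λ m → ¬? (S? (f m))) [1… M ]))
      ≡⟨ sum-filter (λ m → ¬? (S? (f m))) (λ m → n ∸ f m) suc M ⟩
    sum {M} (λ i → 𝟙 (Q? i) * (n ∸ δ i))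
      ≤⟨ sum-mono pairs ⟩
    sum {M} (λ i → sum₂ (λ x y → 𝟙 (at? i x y)))
      ≡⟨ sum-sum₂-comm (λ i x y → 𝟙 (at? i x y)) ⟩
    sum₂ (λ x y → sum (λ i → 𝟙 (at? i x y)))
      ≤⟨ sum₂-mono {n} {n} (λ x y → count≤𝟙 (λ i → at? i x y) (gap? (toℕ x) (toℕ y)) (λ {i} → gap {x} {y} {i})
           (λ (_ , eq) (_ , eq′) → δ-injective (+-cancelˡ-≡ (toℕ x) _ _ (trans (sym eq) eq′)))) ⟩
    sum₂ {n} {n} (λ x y → 𝟙 (gap? (toℕ x) (toℕ y))) ∎
    where
    open ≤-Reasoning
    δ : Fin M → ℕ
    δ i = f (suc (toℕ i))
    Q? : (i : Fin M) → Dec (¬ S (δ i))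
    Q? i = ¬? (S? (δ i))
    at? : (i : Fin M) (x y : Fin n) → Dec (¬ S (δ i) × toℕ y ≡ toℕ x + δ i)
    at? i x y = Q? i ×-dec toℕ y ≟ toℕ x + δ i
    pairs : ∀ i → 𝟙 (Q? i) * (n ∸ δ i) ≤ sum₂ (λ x y → 𝟙 (at? i x y))
    pairs i with Q? i
    ... | no _   = z≤n
    ... | yes ¬s = begin
      (n ∸ δ i) + 0                                      ≡⟨ +-identityʳ _ ⟩
      n ∸ δ i                                            ≤⟨ n∸d≤pairs n (δ i) ⟩
      sum₂ {n} {n} (λ x y → 𝟙 (toℕ y ≟ toℕ x + δ i))
        ≤⟨ sum₂-mono {n} {n} (λ x y → 𝟙-mono (toℕ y ≟ toℕ x + δ i) (yes ¬s ×-dec toℕ y ≟ toℕ x + δ i) (¬s ,_)) ⟩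
      sum₂ {n} {n} (λ x y → 𝟙 (yes ¬s ×-dec toℕ y ≟ toℕ x + δ i)) ∎
    δ-injective : ∀ {i j} → δ i ≡ δ j → i ≡ j
    δ-injective {i} {j} eq = Finₚ.toℕ-injective (suc-injective (*-cancelʳ-≡ (suc (toℕ i)) (suc (toℕ j)) e
      (trans (sym (f≡ (suc (toℕ i)))) (trans eq (f≡ (suc (toℕ j)))))))
    gap : ∀ {x y : Fin n} {i} → ¬ S (δ i) × toℕ y ≡ toℕ x + δ i → Chain e (toℕ x) (toℕ y) × ¬ S (toℕ y ∸ toℕ x)
    gap {x} {y} {i} (¬s , eq) = ≡⇒Chain (toℕ i) (trans eq (cong (_+_ (toℕ x)) (f≡ (suc (toℕ i)))))
      , subst (¬_ ∘ S) (sym (trans (cong (_∸ toℕ x) eq) (m+n∸m≡n (toℕ x) _))) ¬s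

-- The lower bounds

/≤/1 : ∀ U d N .{{_ : NonZero d}} → U ≤ N * d → + U / d ℚ.≤ + N / 1
-- Since `_/_` reduces to lowest terms, the cross-multiplication is done on the unnormalised
-- fractions.
/≤/1 U (suc d) N U≤ = ℚₚ.toℚᵘ-cancel-≤ (ℚᵘₚ.≤-respˡ-≃ (ℚᵘₚ.≃-sym (ℚₚ.toℚᵘ-fromℚᵘ (ℚᵘ.mkℚᵘ (+ U) d)))
  (ℚᵘₚ.≤-respʳ-≃ (ℚᵘₚ.≃-sym (ℚₚ.toℚᵘ-fromℚᵘ (ℚᵘ.mkℚᵘ (+ N) 0)))
    (ℚᵘ.*≤* (subst₂ ℤ._≤_ (ℤₚ.pos-* U 1) (ℤₚ.pos-* N (suc d))
      (ℤ.+≤+ (≤-trans (≤-reflexive (*-identityʳ U)) U≤))))))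

toℕ-inject! : ∀ {n} {i : Fin (suc n)} (j : Fin.Fin′ i) → toℕ (inject! j) ≡ toℕ j
toℕ-inject! {suc n} {suc i} zero    = refl
toℕ-inject! {suc n} {suc i} (suc j) = cong suc (toℕ-inject! j)

-- With `N` any bound on the exchanges of all inputs, one argument serves for both `W n H` and
-- `C n H`.
module Bounds {q n : ℕ} (H : GapSequence q) {N : ℕ}
              (exchanges≤N : ∀ {xs} → Unique xs → exchanges (shellsort {n = n} H xs) ≤ N) where
  open GapSequence H

  input-inversions : ∀ {e} .{{_ : NonZero e}} c i (l : Fin (suc q)) →
    (∀ j → i ≤ toℕ j → j Fin.≤ l → Costs e c (h j)) → i ≤ toℕ l → h l ≡ e →
    ∀ {xs : Vec (Fin n) n} → Unique xs → (∀ j → toℕ j < i → Sorted (h j) xs) → inversions e xs ≤ c * N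
  input-inversions {e} c i l costs i≤l l≡e {xs} unique sorted = begin
    inversions e xs                   ≤⟨ m≤m+n _ (c * 0) ⟩
    inversions e xs + c * 0           ≤⟨ inversions≤exchanges h (λ _ → h-nonZero) i l (state xs 0 0) sorted costs i≤l l≡e ⟩
    c * exchanges (shellsort H xs)    ≤⟨ *-monoʳ-≤ c (exchanges≤N unique) ⟩
    c * N                             ∎
    where open ≤-Reasoning

  -- The reversed array inverts every pair on an `h zero`-chain, and each exchange of the first pass
  -- removes at most one of these inversions.
  D₁≤N : D H zero n ≤ N
  D₁≤N = begin
    D H zero n
      ≤⟨ distances≤pairs {h zero} (S? H zero) n (_* h zero) (λ _ → refl) (M H zero n) ⟩
    sum₂ {n} {n} (λ x y → 𝟙 (gap? {h zero} (S? H zero) (toℕ x) (toℕ y)))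
      ≤⟨ sum₂-mono (λ x y → 𝟙-mono (gap? {h zero} (S? H zero) (toℕ x) (toℕ y)) (inversion? (h zero) reversed x y)
           λ (c , _) → c , arrangement-mono κ (∸-monoʳ-< (proj₁ c) (<⇒≤ (Finₚ.toℕ<n y)))) ⟩
    inversions (h zero) reversed
      ≤⟨ input-inversions 1 0 zero (λ { zero _ _ → 0 , sym (*-identityˡ _) , ≤-refl }) z≤n refl
           (arrangement-unique κ (λ {a} {b} eq → Finₚ.toℕ-injective
              (∸-cancelˡ-≡ (<⇒≤ (Finₚ.toℕ<n a)) (<⇒≤ (Finₚ.toℕ<n b)) eq))) (λ _ ()) ⟩
    1 * N
      ≡⟨ *-identityˡ N ⟩
    N ∎
    where
    open ≤-Reasoning
    κ : Fin n → ℕ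
    κ x = n ∸ toℕ x
    reversed = arrangement κ

  module _ {S : ℕ → Set} (S? : Decidable S) (S0 : S 0) (i : Fin q)
           (S+ : ∀ j → toℕ j < suc (toℕ i) → ∀ {d} m → S d → S (d + m * h j)) where

    private
      hₛ = h (inject₁ i)

    -- An averaging argument over `hₛ` inputs, one per residue: a pair `(x , y)` is inverted by the
    -- input of residue `toℕ x % hₛ`, and each input has at most `c * N` inversions along
    -- `e`-chains.
    gaps≤ : ∀ {e} .{{_ : NonZero e}} c (l : Fin (suc q)) →
      (∀ j → suc (toℕ i) ≤ toℕ j → j Fin.≤ l → Costs e c (h j)) → suc (toℕ i) ≤ toℕ l → h l ≡ e →
      sum₂ {n} {n} (λ x y → 𝟙 (gap? {e} S? (toℕ x) (toℕ y))) ≤ hₛ * (c * N)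
    gaps≤ {e} c l costs i<l l≡e = begin
      sum₂ {n} {n} (λ x y → 𝟙 (gap? {e} S? (toℕ x) (toℕ y)))
        ≤⟨ sum₂-mono (λ x y → 𝟙≤count (λ r → inversion? e (input r) x y) (gap? {e} S? (toℕ x) (toℕ y)) (inverted x y)) ⟩
      sum₂ (λ x y → sum (λ r → 𝟙 (inversion? e (input r) x y)))
        ≡⟨ sum-sum₂-comm (λ r x y → 𝟙 (inversion? e (input r) x y)) ⟨
      sum (λ r → inversions e (input r))
        ≤⟨ sum-mono (λ r → input-inversions c (suc (toℕ i)) l costs i<l l≡e
             (arrangement-unique (κ r) (order-injective n S? S0 hₛ (toℕ r)))
             (λ j j≤i c → <⇒≤ (arrangement-mono (κ r) (order-chain n S? S0 (S+ j j≤i) hₛ (toℕ r) c)))) ⟩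
      sum {hₛ} (λ _ → c * N)
        ≡⟨ sum-const hₛ (c * N) ⟩
      hₛ * (c * N) ∎
      where
      open ≤-Reasoning
      κ : Fin hₛ → Fin n → ℕ
      κ r = order n S? S0 hₛ (toℕ r)
      input : Fin hₛ → Vec (Fin n) n
      input r = arrangement (κ r)
      inverted : ∀ x y → Chain e (toℕ x) (toℕ y) × ¬ S (toℕ y ∸ toℕ x) →
                 ∃ λ r → Chain e (toℕ x) (toℕ y) × lookup (input r) y Fin.< lookup (input r) x
      inverted x y (c , ¬s) = fromℕ< r<hₛ , c , arrangement-mono (κ (fromℕ< r<hₛ))
        (subst (λ r → order n S? S0 hₛ r y < order n S? S0 hₛ r x) (sym (Finₚ.toℕ-fromℕ< r<hₛ))
          (order-inverts n S? S0 (S+ (inject₁ i) (s≤s (≤-reflexive (Finₚ.toℕ-inject₁ i)))) (proj₁ c) ¬s))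
        where
        r<hₛ = m%n<n (toℕ x) hₛ

  module _ (i : Fin q) where

    private
      s : Fin (suc (suc q))
      -- Here `toℕ s` is `toℕ i + 1`, so in 1-based terms `hₛ` is the gap of index `s` and
      -- `h (suc i)` the next one. Also `s` is `inject₁ (suc i)`, the index occurring in
      -- `D H (suc i)`.
      s = suc (inject₁ i)

      hₛ : ℕ
      hₛ = h (inject₁ i)

    S-0 : S H s 0
    S-0 = combination-0 {toℕ s} (λ i → h (inject! {i = s} i))

    S-+ : ∀ j → toℕ j < suc (toℕ i) → ∀ {d} m → S H s d → S H s (d + m * h j)
    S-+ j j≤i {d} m Sd =
      subst (λ j → S H s (d + m * h j)) inject!≡ (combination-+ {toℕ s} (λ i → h (inject! {i = s} i)) j′ m {d} Sd)
      where
      j<s : toℕ j < toℕ s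
      j<s = subst (λ i → toℕ j < suc i) (sym (Finₚ.toℕ-inject₁ i)) j≤i
      j′ : Fin (toℕ s)
      j′ = fromℕ< j<s
      inject!≡ : inject! {i = s} j′ ≡ j
      inject!≡ = Finₚ.toℕ-injective (trans (toℕ-inject! {i = s} j′) (Finₚ.toℕ-fromℕ< j<s))

    D≤ : D H (suc i) n ≤ hₛ * N
    D≤ = begin
      D H (suc i) n
        ≤⟨ distances≤pairs {h (suc i)} {S H s} (S? H s) n (_* h (suc i)) (λ _ → refl) (M H (suc i) n) ⟩
      sum₂ {n} {n} (λ x y → 𝟙 (gap? {h (suc i)} (S? H s) (toℕ x) (toℕ y)))
        ≤⟨ gaps≤ {S H s} (S? H s) S-0 i (λ j j≤i {d} → S-+ j j≤i {d}) 1 (suc i) costs ≤-refl refl ⟩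
      hₛ * (1 * N)
        ≡⟨ cong (_*_ hₛ) (*-identityˡ N) ⟩
      hₛ * N ∎
      where
      open ≤-Reasoning
      costs : ∀ j → suc (toℕ i) ≤ toℕ j → j Fin.≤ suc i → Costs (h (suc i)) 1 (h j)
      -- Only the pass of gap `h (suc i)` itself is involved, and its exchanges join neighbours on
      -- the chain, hence `c = 1`.
      costs j i<j j≤i = 0 , trans (cong h (Finₚ.toℕ-injective (≤-antisym j≤i i<j))) (sym (*-identityˡ _)) , ≤-refl

    ⌈D/h⌉≤N : ⌈ D H (suc i) n / hₛ ⌉ ≤ N
    ⌈D/h⌉≤N = s≤s⁻¹ (m<n*o⇒m/o<n (begin-strict
      D H (suc i) n + (hₛ ∸ 1)   ≤⟨ +-monoˡ-≤ (hₛ ∸ 1) D≤ ⟩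
      -- Rounding up adds `hₛ ∸ 1`, just short of the next multiple of `hₛ`.
      hₛ * N + (hₛ ∸ 1)          <⟨ +-monoʳ-< (hₛ * N) (≤-reflexive (m+[n∸m]≡n (h≥1 (inject₁ i)))) ⟩
      hₛ * N + hₛ                ≡⟨ trans (+-comm (hₛ * N) hₛ) (cong (_+_ hₛ) (*-comm hₛ N)) ⟩
      suc N * hₛ                 ∎))
      where open ≤-Reasoning

    -- With `e = 1` all inversions count, and every pass from gap `h (suc i)` to the final gap 1 may
    -- remove some. The largest of these gaps is `h (suc i)`, so `2 * h (suc i) ∸ 1` covers the loss
    -- per exchange in each.
    U≤ : U H s n ≤ N * (hₛ * (2 * h (suc i) ∸ 1))
    U≤ = begin
      U H s n
        ≤⟨ distances≤pairs {1} {S H s} (S? H s) n id (λ m → sym (*-identityʳ m)) (n ∸ 1) ⟩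
      sum₂ {n} {n} (λ x y → 𝟙 (gap? {1} (S? H s) (toℕ x) (toℕ y)))
        ≤⟨ gaps≤ {S H s} (S? H s) S-0 i (λ j j≤i {d} → S-+ j j≤i {d}) (2 * h (suc i) ∸ 1) (fromℕ q) costs
             (subst (toℕ i <_) (sym (Finₚ.toℕ-fromℕ q)) (Finₚ.toℕ<n i)) last≡1 ⟩
      hₛ * ((2 * h (suc i) ∸ 1) * N)
        ≡⟨ trans (sym (*-assoc hₛ _ N)) (*-comm _ N) ⟩
      N * (hₛ * (2 * h (suc i) ∸ 1)) ∎
      where
      open ≤-Reasoning
      h-mono : ∀ j → suc (toℕ i) ≤ toℕ j → h j ≤ h (suc i)
      h-mono j i<j with m≤n⇒m<n∨m≡n i<j
      ... | inj₁ 1+i<j = <⇒≤ (decreasing 1+i<j)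
      ... | inj₂ 1+i≡j = ≤-reflexive (cong h (Finₚ.toℕ-injective (sym 1+i≡j)))
      odd : ∀ p → 2 * suc p ∸ 1 ≡ p + suc p
      odd p = cong (λ m → p + suc m) (+-identityʳ p)
      costs : ∀ j → suc (toℕ i) ≤ toℕ j → j Fin.≤ fromℕ q → Costs 1 (2 * h (suc i) ∸ 1) (h j)
      costs j i<j _ with m≤n⇒∃[o]m+o≡n (h≥1 j)
      ... | p , eq = p , trans (sym eq) (sym (*-identityʳ (suc p)))
        , ≤-trans (≤-reflexive (trans (sym (odd p)) (cong (λ g → 2 * g ∸ 1) eq))) (∸-monoˡ-≤ 1 (*-monoʳ-≤ 2 (h-mono j i<j)))

  bound≤ : D H zero n ⊔ max 0 (tabulate λ (i : Fin q) → ⌈ D H (suc i) n / h (inject₁ i) ⌉) ≤ N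
  bound≤ = ⊔-lub D₁≤N (max≤v⁺ z≤n (Allₚ.tabulate⁺ ⌈D/h⌉≤N))

  ratio≤ : ∀ i → + U H (suc (inject₁ i)) n / (h (inject₁ i) * (2 * h (suc i) ∸ 1)) ℚ.≤ + N / 1
  ratio≤ i = /≤/1 (U H (suc (inject₁ i)) n) (h (inject₁ i) * (2 * h (suc i) ∸ 1)) N (U≤ i)

worst-case : ∀ {n} (f : Vec (Fin n) n → ℕ) {xs} → Unique xs → f xs ≤ max 0 (List.map f (inputs n))
worst-case {n} f {xs} unique = v≤max⁺ 0 (List.map f (inputs n))
  (inj₂ (Anyₚ.map⁺ (Any.map (λ { refl → ≤-refl }) (∈-inputs unique))))

theorem4p2 : ∀ (q n : ℕ) (H : GapSequence q) → n ≥ 1 →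
    let
      open GapSequence H
      bound = D H zero n ⊔ max 0 (tabulate λ (i : Fin q) → ⌈ D H (suc i) n / h (inject₁ i) ⌉)
      ratio = λ (i : Fin q) → + U H (suc (inject₁ i)) n / (h (inject₁ i) * (2 * h (suc i) ∸ 1))
    in
      (W n H ≥ bound)
    × (∀ i → + W n H / 1 ℚ.≥ ratio i)
    × (C n H ≥ bound)
    × (∀ i → + C n H / 1 ℚ.≥ ratio i)
theorem4p2 q n H _ = bound≤ , ratio≤ , bound≤′ , ratio≤′
  where
  open Bounds {n = n} H (worst-case (exchanges ∘ shellsort H))
  -- Every exchange comes with a comparison, so `C n H` also bounds the exchanges of all inputs.
  open Bounds {n = n} H (λ {xs} unique → ≤-trans (exchanges≤comparisons H xs) (worst-case (comparisons ∘ shellsort H) unique))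
    using () renaming (bound≤ to bound≤′; ratio≤ to ratio≤′)
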